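{- Let $\varphi=(1+\sqrt5)/2$ and let $s_Z$ be the Zeckendorf sum of digits function. Let $I_Z=(I_Z(n))_{n\ge1}$ be the increasing enumeration of the points of increase of $s_Z$, let $C_Z=(C_Z(n))_{n\ge1}$ be the increasing enumeration of the points of constancy of $s_Z$, and let $D_Z=(D_Z(n))_{n\ge1}$ be defined by $D_Z(1)=-1$ and, for $n\ge1$, $D_Z(n+1)$ is the $n$-th smallest point of decrease of $s_Z$. Then: (i) $I_Z(n)=\lfloor n\varphi\rfloor+n-2$ for all $n\ge1$; (ii) the set of points of constancy of $s_Z$ equals $\{2\lfloor n\varphi\rfloor+n-2:\ n\ge1\}\cup\{3\lfloor n\varphi\rfloor+2n-3:\ n\ge1\}$, i.e. $C_Z$ is the increasing enumeration of this union; (iii) $D_Z(n)=2\lfloor n\varphi\rfloor+n-4$ for all $n\ge1$.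
   Context: Fibonacci numbers: $F_0=0$, $F_1=1$, $F_n=F_{n-1}+F_{n-2}$ for $n\ge2$. Every integer $N\ge0$ can be written uniquely (ignoring leading zeros) as $N=\sum_{i\ge0}d_i(N)F_{i+2}$ with digits $d_i(N)\in\{0,1\}$ such that no two consecutive digits $d_i,d_{i+1}$ are both $1$ (Zeckendorf expansion). The Zeckendorf sum of digits function is $s_Z(N)=\sum_{i\ge0}d_i(N)$ for $N\ge0$. With $\Delta s_Z(N)=s_Z(N+1)-s_Z(N)$, an integer $N\ge0$ is a point of increase, of constancy, or of decrease of $s_Z$ according as $\Delta s_Z(N)>0$, $=0$, or $<0$. -}

module Defs where

open import Data.Nat.Base as ℕ
  using (ℕ; zero; suc; _+_; _*_; _∸_; _≤_; _<_; z≤n; s≤s; NonZero)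
import Data.Nat.Properties as ℕₚ
open import Data.Nat.Tactic.RingSolver using (solve-∀)
open import Data.Integer.Base as ℤ using (ℤ; +_)
import Data.Integer.Properties as ℤₚ
import Data.Integer.Tactic.RingSolver as ℤSolver
open import Data.Rational.Unnormalised.Base as ℚ using (ℚᵘ; mkℚᵘ; 0ℚᵘ; ½; *≡*; *≤*)
import Data.Rational.Unnormalised.Properties as ℚₚ
open import Data.Fin.Base using (Fin; toℕ)
open import Data.Fin.Patterns using (0F; 1F)
open import Data.List.Base using (List; []; _∷_; _++_; length; replicate; map)
open import Data.Nat.ListAction using (sum)
open import Data.List.Properties using (length-++; length-replicate)
open import Data.List.Relation.Unary.Linked using (Linked; []; [-]; _∷_; tail)
open import Data.Product.Base using (∃; _×_; _,_; proj₁; proj₂)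
open import Data.Sum.Base using (_⊎_; inj₁; inj₂)
open import Data.Empty using (⊥-elim)
open import Relation.Nullary using (¬_; Dec; yes; no; _×-dec_; _⊎-dec_)
open import Relation.Unary using (Pred; Decidable)
open import Relation.Binary.PropositionalEquality
  using (_≡_; refl; sym; trans; cong; cong₂; subst; subst₂; module ≡-Reasoning)
open import Level using (0ℓ)

F : ℕ → ℕ
F zero          = 0
F (suc zero)    = 1
F (suc (suc n)) = F (suc n) + F n

Digit : Set
Digit = Fin 2

-- Digit strings are written most significant digit first, so the digit
-- followed by i further digits has weight F (2 + i).
value : List Digit → ℕ
value []       = 0
value (d ∷ ds) = toℕ d * F (2 + length ds) + value ds

NotBothOne : Digit → Digit → Set
NotBothOne d e = ¬ (d ≡ 1F × e ≡ 1F)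

record Zeckendorf (N : ℕ) : Set where
  constructor mkZeckendorf
  field
    digits   : List Digit
    sparse   : Linked NotBothOne digits
    value≡   : value digits ≡ N

digitSum : List Digit → ℕ
digitSum ds = sum (map toℕ ds)

greedy : ℕ → ℕ → List Digit
greedy zero    N = []
greedy (suc k) N with F (2 + k) ℕₚ.≤? N
... | yes _ = 1F ∷ greedy k (N ∸ F (2 + k))
... | no  _ = 0F ∷ greedy k N

length-greedy : ∀ k N → length (greedy k N) ≡ k
length-greedy zero    N = refl
length-greedy (suc k) N with F (2 + k) ℕₚ.≤? N
... | yes _ = cong suc (length-greedy k _)
... | no  _ = cong suc (length-greedy k _)

m<n+o⇒m∸n<o : ∀ {m n o} → n ≤ m → m < n + o → m ∸ n < o
m<n+o⇒m∸n<o {m} {n} n≤m m<n+o =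
  ℕₚ.+-cancelˡ-< n _ _ (subst (_< _) (sym (ℕₚ.m+[n∸m]≡n n≤m)) m<n+o)

value-greedy : ∀ k N → N < F (2 + k) → value (greedy k N) ≡ N
value-greedy zero    zero N<F = refl
value-greedy zero    (suc N) (s≤s ())
value-greedy (suc k) N N<F with F (2 + k) ℕₚ.≤? N
... | no F≰N = value-greedy k N (ℕₚ.≰⇒> F≰N)
... | yes F≤N rewrite length-greedy k (N ∸ F (2 + k)) | ℕₚ.+-identityʳ (F (2 + k)) =
  trans (cong (λ v → F (2 + k) + v) (value-greedy k _
          (ℕₚ.<-≤-trans (m<n+o⇒m∸n<o F≤N N<F) (ℕₚ.m≤m+n (F (1 + k)) (F k)))))
        (ℕₚ.m+[n∸m]≡n F≤N)

sparse-0∷ : ∀ {ds} → Linked NotBothOne ds → Linked NotBothOne (0F ∷ ds)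
sparse-0∷ {[]}    _ = [-]
sparse-0∷ {_ ∷ _} l = (λ ()) ∷ l

sparse-greedy : ∀ k N → N < F (2 + k) → Linked NotBothOne (greedy k N)
sparse-1∷greedy : ∀ k N → N < F (1 + k) → Linked NotBothOne (1F ∷ greedy k N)

sparse-greedy zero    N _ = []
sparse-greedy (suc k) N N<F with F (2 + k) ℕₚ.≤? N
... | no F≰N = sparse-0∷ (sparse-greedy k N (ℕₚ.≰⇒> F≰N))
... | yes F≤N = sparse-1∷greedy k _ (m<n+o⇒m∸n<o F≤N N<F)

sparse-1∷greedy zero    N _ = [-]
sparse-1∷greedy (suc k) N N<F with F (2 + k) ℕₚ.≤? N
... | no  _   = (λ ()) ∷ sparse-0∷ (sparse-greedy k N N<F)
... | yes F≤N = ⊥-elim (ℕₚ.<⇒≱ N<F F≤N)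

F-pos : ∀ n → 1 ≤ F (1 + n)
F-pos zero    = ℕₚ.≤-refl
F-pos (suc n) = ℕₚ.≤-trans (F-pos n) (ℕₚ.m≤m+n _ _)

n<F[2+n] : ∀ n → n < F (2 + n)
n<F[2+n] zero    = s≤s z≤n
n<F[2+n] (suc n) = begin
  2 + n                      ≡⟨ ℕₚ.+-comm 1 (1 + n) ⟩
  (1 + n) + 1                ≤⟨ ℕₚ.+-mono-≤ (n<F[2+n] n) (F-pos n) ⟩
  F (2 + n) + F (1 + n)      ∎
  where open ℕₚ.≤-Reasoning

zeckendorf : ∀ N → Zeckendorf N
zeckendorf N = mkZeckendorf (greedy N N) (sparse-greedy N N (n<F[2+n] N))
                            (value-greedy N N (n<F[2+n] N))

value<F : ∀ {ds} → Linked NotBothOne ds → value ds < F (2 + length ds)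
value<F {[]}           _ = s≤s z≤n
value<F {0F ∷ ds}      l = ℕₚ.<-≤-trans (value<F (tail l)) (ℕₚ.m≤m+n _ _)
value<F {1F ∷ []}      l = s≤s (s≤s z≤n)
value<F {1F ∷ 0F ∷ ds} (_ ∷ l) = begin-strict
  1 * F (3 + length ds) + value ds        ≡⟨ cong (_+ value ds) (ℕₚ.*-identityˡ _) ⟩
  F (3 + length ds) + value ds            <⟨ ℕₚ.+-monoʳ-< (F (3 + length ds)) (value<F (tail l)) ⟩
  F (3 + length ds) + F (2 + length ds)   ∎
  where open ℕₚ.≤-Reasoning
value<F {1F ∷ 1F ∷ ds} (r ∷ _) = ⊥-elim (r (refl , refl))

unique-sameLength : ∀ {ds es} → Linked NotBothOne ds → Linked NotBothOne es →
                    length ds ≡ length es → value ds ≡ value es → ds ≡ es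
unique-sameLength {[]} {[]} _ _ _ _ = refl
unique-sameLength {[]} {_ ∷ _} _ _ () _
unique-sameLength {_ ∷ _} {[]} _ _ () _
unique-sameLength {0F ∷ ds} {0F ∷ es} l m len val =
  cong (0F ∷_) (unique-sameLength (tail l) (tail m) (ℕₚ.suc-injective len) val)
unique-sameLength {1F ∷ ds} {1F ∷ es} l m len val =
  cong (1F ∷_) (unique-sameLength (tail l) (tail m) len′
    (ℕₚ.+-cancelˡ-≡ (1 * F (2 + length ds)) _ _
      (trans val (cong (λ k → 1 * F (2 + k) + value es) (sym len′)))))
  where len′ = ℕₚ.suc-injective len
unique-sameLength {0F ∷ ds} {1F ∷ es} l m len val =
  ⊥-elim (ℕₚ.<⇒≢ (ℕₚ.<-≤-trans (value<F (tail l))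
    (ℕₚ.≤-trans (ℕₚ.≤-reflexive (trans (cong (λ k → F (2 + k)) (ℕₚ.suc-injective len))
                                       (sym (ℕₚ.*-identityˡ _))))
                (ℕₚ.m≤m+n _ (value es)))) val)
unique-sameLength {1F ∷ ds} {0F ∷ es} l m len val =
  sym (unique-sameLength m l (sym len) (sym val))

0s : ℕ → List Digit
0s k = replicate k 0F

sparse-0s++ : ∀ k {ds} → Linked NotBothOne ds → Linked NotBothOne (0s k ++ ds)
sparse-0s++ zero    l = l
sparse-0s++ (suc k) l = sparse-0∷ (sparse-0s++ k l)

value-0s++ : ∀ k ds → value (0s k ++ ds) ≡ value ds
value-0s++ zero    ds = refl
value-0s++ (suc k) ds = value-0s++ k ds

digitSum-0s++ : ∀ k ds → digitSum (0s k ++ ds) ≡ digitSum ds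
digitSum-0s++ zero    ds = refl
digitSum-0s++ (suc k) ds = digitSum-0s++ k ds

length-0s++ : ∀ k ds → length (0s k ++ ds) ≡ k + length ds
length-0s++ k ds = trans (length-++ (0s k)) (cong (_+ length ds) (length-replicate k))

-- Uniqueness up to leading zeros: the strings agree once both are padded
-- to a common length.
zeckendorf-unique : ∀ {N} (x y : Zeckendorf N) →
  let open Zeckendorf in
  0s (length (digits y)) ++ digits x ≡ 0s (length (digits x)) ++ digits y
zeckendorf-unique (mkZeckendorf ds l p) (mkZeckendorf es m q) =
  unique-sameLength (sparse-0s++ (length es) l) (sparse-0s++ (length ds) m)
    (trans (length-0s++ (length es) ds)
      (trans (ℕₚ.+-comm (length es) (length ds)) (sym (length-0s++ (length ds) es))))
    (trans (value-0s++ (length es) ds)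
      (trans (trans p (sym q)) (sym (value-0s++ (length ds) es))))

sZ : ℕ → ℕ
sZ N = digitSum (Zeckendorf.digits (zeckendorf N))

sZ-unique : ∀ {N} (x : Zeckendorf N) → sZ N ≡ digitSum (Zeckendorf.digits x)
sZ-unique {N} x = begin
  digitSum ds                        ≡⟨ digitSum-0s++ (length es) ds ⟨
  digitSum (0s (length es) ++ ds)    ≡⟨ cong digitSum (zeckendorf-unique (zeckendorf N) x) ⟩
  digitSum (0s (length ds) ++ es)    ≡⟨ digitSum-0s++ (length ds) es ⟩
  digitSum es                        ∎
  where
  open ≡-Reasoning
  ds = Zeckendorf.digits (zeckendorf N)
  es = Zeckendorf.digits x

ΔsZ : ℕ → ℤ
ΔsZ N = + sZ (N + 1) ℤ.- + sZ N

Increase Constancy Decrease : Pred ℕ 0ℓ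
Increase  N = ΔsZ N ℤ.> + 0
Constancy N = ΔsZ N ≡ + 0
Decrease  N = ΔsZ N ℤ.< + 0

increase? : Decidable Increase
increase? N = + 0 ℤₚ.<? ΔsZ N

constancy? : Decidable Constancy
constancy? N = ΔsZ N ℤₚ.≟ + 0

decrease? : Decidable Decrease
decrease? N = ΔsZ N ℤₚ.<? + 0

record IsIncreasingEnumeration (P : Pred ℕ 0ℓ) (a : (n : ℕ) → .{{NonZero n}} → ℕ) : Set where
  field
    increasing : ∀ m n .{{_ : NonZero m}} .{{_ : NonZero n}} → m < n → a m < a n
    sound      : ∀ n .{{_ : NonZero n}} → P (a n)
    complete   : ∀ {N} → P N → ∃ λ k → a (suc k) ≡ N

Unbounded : Pred ℕ 0ℓ → Set
Unbounded P = ∀ m → ∃ λ N → m ≤ N × P N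

module Enumeration {P : Pred ℕ 0ℓ} (P? : Decidable P) (unbounded : Unbounded P) where

  LeastFrom : ℕ → ℕ → Set
  LeastFrom m N = m ≤ N × P N × (∀ {M} → m ≤ M → P M → N ≤ M)

  search : ∀ k m → P (k + m) → ∃ (LeastFrom m)
  search k m p with P? m
  search k       m p | yes Pm = m , ℕₚ.≤-refl , Pm , λ m≤M _ → m≤M
  search zero    m p | no ¬Pm = ⊥-elim (¬Pm p)
  search (suc k) m p | no ¬Pm with search k (suc m) (subst P (sym (ℕₚ.+-suc k m)) p)
  ... | N , m<N , PN , least =
    N , ℕₚ.<⇒≤ m<N , PN , λ m≤M PM →
      least (ℕₚ.≤∧≢⇒< m≤M (λ m≡M → ¬Pm (subst P (sym m≡M) PM))) PM

  leastFrom : ∀ m → ∃ (LeastFrom m)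
  leastFrom m with unbounded m
  ... | N , m≤N , PN = search (N ∸ m) m (subst P (sym (ℕₚ.m∸n+n≡m m≤N)) PN)

  nth : (n : ℕ) → .{{NonZero n}} → ℕ
  nth (suc zero)    = proj₁ (leastFrom 0)
  nth (suc (suc n)) = proj₁ (leastFrom (suc (nth (suc n))))

  private
    step : ∀ n → nth (suc n) < nth (suc (suc n))
    step n = proj₁ (proj₂ (leastFrom (suc (nth (suc n)))))

    increasing : ∀ d m → nth (suc m) < nth (suc (suc (d + m)))
    increasing zero    m = step m
    increasing (suc d) m = ℕₚ.<-trans (increasing d m) (step (suc (d + m)))

    sound : ∀ n → P (nth (suc n))
    sound zero    = proj₁ (proj₂ (proj₂ (leastFrom 0)))
    sound (suc n) = proj₁ (proj₂ (proj₂ (leastFrom (suc (nth (suc n))))))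

    n≤nth : ∀ n → n ≤ nth (suc n)
    n≤nth zero    = z≤n
    n≤nth (suc n) = ℕₚ.≤-<-trans (n≤nth n) (step n)

    complete : ∀ n {N} → P N → N ≤ nth (suc n) → ∃ λ k → nth (suc k) ≡ N
    complete zero PN N≤ =
      0 , ℕₚ.≤-antisym (proj₂ (proj₂ (proj₂ (leastFrom 0))) z≤n PN) N≤
    complete (suc n) {N} PN N≤ with N ℕₚ.≤? nth (suc n)
    ... | yes N≤′ = complete n PN N≤′
    ... | no  N≰  = suc n ,
      ℕₚ.≤-antisym (proj₂ (proj₂ (proj₂ (leastFrom (suc (nth (suc n)))))) (ℕₚ.≰⇒> N≰) PN) N≤

  nth-isIncreasingEnumeration : IsIncreasingEnumeration P nth
  nth-isIncreasingEnumeration = record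
    { increasing = λ where
        (suc m) (suc n) (s≤s m<n) →
          subst (λ k → nth (suc m) < nth (suc k))
                (trans (sym (ℕₚ.+-suc (n ∸ suc m) m)) (ℕₚ.m∸n+n≡m m<n))
                (increasing (n ∸ suc m) m)
    ; sound    = λ where (suc n) → sound n
    ; complete = λ {N} PN → complete N PN (n≤nth N)
    }

-- Each of the three sets is unbounded: the strings 1 0 ⋯ 0 ++ t with
-- t = 0000, 0001, 0101 have successors with t = 0001, 0010, 1000.

private
  long : ℕ → List Digit → List Digit
  long m t = 1F ∷ 0s (suc m) ++ t

  length-long : ∀ m t → length (0s (suc m) ++ t) ≡ suc m + length t
  length-long m t = length-0s++ (suc m) t

  long-sparse : ∀ m {t} → Linked NotBothOne t → Linked NotBothOne (long m t)
  long-sparse m l = (λ ()) ∷ sparse-0s++ (suc m) l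

  value-long : ∀ m t → value (long m t) ≡ F (2 + (suc m + length t)) + value t
  value-long m t = cong₂ _+_
    (trans (ℕₚ.*-identityˡ _) (cong (λ k → F (2 + k)) (length-long m t)))
    (value-0s++ (suc m) t)

  digitSum-long : ∀ m t → digitSum (long m t) ≡ suc (digitSum t)
  digitSum-long m t = cong suc (digitSum-0s++ (suc m) t)

  long-Δ : ∀ m {t u} → Linked NotBothOne t → Linked NotBothOne u →
           length t ≡ length u → value u ≡ value t + 1 →
           ΔsZ (value (long m t)) ≡ + suc (digitSum u) ℤ.- + suc (digitSum t)
  long-Δ m {t} {u} lt lu len val = cong₂ (λ x y → + x ℤ.- + y)
    (trans (sZ-unique (mkZeckendorf (long m u) (long-sparse m lu) eq)) (digitSum-long m u))
    (trans (sZ-unique (mkZeckendorf (long m t) (long-sparse m lt) refl)) (digitSum-long m t))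
    where
    open ≡-Reasoning
    eq : value (long m u) ≡ value (long m t) + 1
    eq = begin
      value (long m u)                               ≡⟨ value-long m u ⟩
      F (2 + (suc m + length u)) + value u           ≡⟨ cong₂ (λ k v → F (2 + (suc m + k)) + v) (sym len) val ⟩
      F (2 + (suc m + length t)) + (value t + 1)     ≡⟨ ℕₚ.+-assoc (F (2 + (suc m + length t))) _ 1 ⟨
      F (2 + (suc m + length t)) + value t + 1       ≡⟨ cong (_+ 1) (value-long m t) ⟨
      value (long m t) + 1                           ∎

  long-large : ∀ m t → m ≤ value (long m t)
  long-large m t = begin
    m                                        ≤⟨ ℕₚ.m≤n+m m 1 ⟩
    suc m                                    ≤⟨ ℕₚ.m≤m+n (suc m) (length t) ⟩
    suc m + length t                         ≤⟨ ℕₚ.<⇒≤ (n<F[2+n] _) ⟩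
    F (2 + (suc m + length t))               ≤⟨ ℕₚ.m≤m+n _ (value t) ⟩
    F (2 + (suc m + length t)) + value t     ≡⟨ value-long m t ⟨
    value (long m t)                         ∎
    where open ℕₚ.≤-Reasoning

  0000-sparse : Linked NotBothOne (0F ∷ 0F ∷ 0F ∷ 0F ∷ [])
  0000-sparse = sparse-0s++ 4 []

  0001-sparse : Linked NotBothOne (0F ∷ 0F ∷ 0F ∷ 1F ∷ [])
  0001-sparse = sparse-0s++ 3 [-]

  0010-sparse : Linked NotBothOne (0F ∷ 0F ∷ 1F ∷ 0F ∷ [])
  0010-sparse = sparse-0s++ 2 ((λ ()) ∷ [-])

  0101-sparse : Linked NotBothOne (0F ∷ 1F ∷ 0F ∷ 1F ∷ [])
  0101-sparse = sparse-0∷ ((λ ()) ∷ sparse-0∷ [-])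

  1000-sparse : Linked NotBothOne (1F ∷ 0F ∷ 0F ∷ 0F ∷ [])
  1000-sparse = (λ ()) ∷ sparse-0s++ 3 []

increase-unbounded : Unbounded Increase
increase-unbounded m = _ , long-large m _ ,
  subst (ℤ._> + 0) (sym (long-Δ m 0000-sparse 0001-sparse refl refl)) (ℤ.+<+ (s≤s z≤n))

constancy-unbounded : Unbounded Constancy
constancy-unbounded m = _ , long-large m _ ,
  long-Δ m 0001-sparse 0010-sparse refl refl

decrease-unbounded : Unbounded Decrease
decrease-unbounded m = _ , long-large m _ ,
  subst (ℤ._< + 0) (sym (long-Δ m 0101-sparse 1000-sparse refl refl)) ℤ.-<+

IZ : (n : ℕ) → .{{NonZero n}} → ℕ
IZ = Enumeration.nth increase? increase-unbounded

CZ : (n : ℕ) → .{{NonZero n}} → ℕ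
CZ = Enumeration.nth constancy? constancy-unbounded

DZ : (n : ℕ) → .{{NonZero n}} → ℤ
DZ (suc zero)    = ℤ.-1ℤ
DZ (suc (suc n)) = + Enumeration.nth decrease? decrease-unbounded (suc n)

infix  8 _⊕_√5
infixl 7 _·_
infixl 6 _⊖_
infix  4 _≤√_ _<√_ _≤√?_

record ℚ√5 : Set where
  constructor _⊕_√5
  field
    rat irr : ℚᵘ

_⊖_ : ℚ√5 → ℚ√5 → ℚ√5
(a ⊕ b √5) ⊖ (c ⊕ d √5) = (a ℚ.- c) ⊕ (b ℚ.- d) √5

_·_ : ℚ√5 → ℚ√5 → ℚ√5
(a ⊕ b √5) · (c ⊕ d √5) =
  (a ℚ.* c ℚ.+ (+ 5 ℚ./ 1) ℚ.* (b ℚ.* d)) ⊕ (a ℚ.* d ℚ.+ b ℚ.* c) √5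

-- The order induced by ℚ(√5) ⊆ ℝ with √5 > 0: a + b√5 ≥ 0 holds iff
-- a ≥ |b|√5 or b√5 ≥ |a|.
NonNegative√ : ℚ√5 → Set
NonNegative√ (a ⊕ b √5) =
    (0ℚᵘ ℚ.≤ a × (+ 5 ℚ./ 1) ℚ.* (b ℚ.* b) ℚ.≤ a ℚ.* a)
  ⊎ (0ℚᵘ ℚ.≤ b × a ℚ.* a ℚ.≤ (+ 5 ℚ./ 1) ℚ.* (b ℚ.* b))

_≤√_ _<√_ : ℚ√5 → ℚ√5 → Set
x ≤√ y = NonNegative√ (y ⊖ x)
x <√ y = ¬ (y ≤√ x)

_≤√?_ : ∀ x y → Dec (x ≤√ y)
(a ⊕ b √5) ≤√? (c ⊕ d √5) =
  ((_ ℚₚ.≤? _) ×-dec (_ ℚₚ.≤? _)) ⊎-dec ((_ ℚₚ.≤? _) ×-dec (_ ℚₚ.≤? _))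

fromℤ : ℤ → ℚ√5
fromℤ z = (z ℚ./ 1) ⊕ 0ℚᵘ √5

φ : ℚ√5
φ = ½ ⊕ ½ √5

record IsFloor (x : ℚ√5) (z : ℤ) : Set where
  field
    lower : fromℤ z ≤√ x
    upper : x <√ fromℤ (z ℤ.+ + 1)

-- The largest m ≤ k with m ≤ nφ (or 0).
searchFloor : ℕ → ℕ → ℕ
searchFloor n zero    = 0
searchFloor n (suc k) with fromℤ (+ suc k) ≤√? fromℤ (+ n) · φ
... | yes _ = suc k
... | no  _ = searchFloor n k

-- ⌊ n φ⌋; the bound 2n suffices because φ < 2.
⌊_φ⌋ : ℕ → ℕ
⌊ n φ⌋ = searchFloor n (2 * n)

NonNegative√-resp-≃ : ∀ {a a′ b b′} → a ℚ.≃ a′ → b ℚ.≃ b′ →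
                      NonNegative√ (a ⊕ b √5) → NonNegative√ (a′ ⊕ b′ √5)
NonNegative√-resp-≃ {a} {a′} {b} {b′} a≃ b≃ = λ where
    (inj₁ (0≤a , le)) → inj₁ (ℚₚ.≤-respʳ-≃ a≃ 0≤a , ℚₚ.≤-respˡ-≃ 5b² (ℚₚ.≤-respʳ-≃ a² le))
    (inj₂ (0≤b , le)) → inj₂ (ℚₚ.≤-respʳ-≃ b≃ 0≤b , ℚₚ.≤-respˡ-≃ a² (ℚₚ.≤-respʳ-≃ 5b² le))
  where
  a² : a ℚ.* a ℚ.≃ a′ ℚ.* a′
  a² = ℚₚ.*-cong a≃ a≃
  5b² : (+ 5 ℚ./ 1) ℚ.* (b ℚ.* b) ℚ.≃ (+ 5 ℚ./ 1) ℚ.* (b′ ℚ.* b′)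
  5b² = ℚₚ.*-congˡ {+ 5 ℚ./ 1} (ℚₚ.*-cong b≃ b≃)

rat≃ : ∀ z w → ℚ√5.rat (fromℤ z · φ ⊖ fromℤ w) ℚ.≃ (z ℤ.- + 2 ℤ.* w) ℚ./ 2
rat≃ z w = *≡* (eq z w)
  where
  eq : ∀ z w → (((z ℤ.* + 1) ℤ.* + 2 ℤ.+ + 0 ℤ.* + 2) ℤ.* + 1 ℤ.+ ℤ.- w ℤ.* + 4) ℤ.* + 2
             ≡ (z ℤ.- + 2 ℤ.* w) ℤ.* + 4
  eq = ℤSolver.solve-∀

irr≃ : ∀ z w → ℚ√5.irr (fromℤ z · φ ⊖ fromℤ w) ℚ.≃ z ℚ./ 2
irr≃ z w = *≡* (eq z)
  where
  eq : ∀ z → (((z ℤ.* + 1) ℤ.* + 2 ℤ.+ + 0 ℤ.* + 2) ℤ.* + 1 ℤ.+ + 0 ℤ.* + 4) ℤ.* + 2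
           ≡ z ℤ.* + 4
  eq = ℤSolver.solve-∀

Halves : ℤ → ℤ → Set
Halves p z = (+ 0 ℤ.≤ p × + 5 ℤ.* (z ℤ.* z) ℤ.≤ p ℤ.* p)
           ⊎ (+ 0 ℤ.≤ z × p ℤ.* p ℤ.≤ + 5 ℤ.* (z ℤ.* z))

halves⁺ : ∀ p z → Halves p z → NonNegative√ ((p ℚ./ 2) ⊕ (z ℚ./ 2) √5)
halves⁺ p z = λ where
    (inj₁ (h , le)) → inj₁ (half p h , *≤* (ℤₚ.*-monoʳ-≤-nonNeg (+ 4) le))
    (inj₂ (h , le)) → inj₂ (half z h , *≤* (ℤₚ.*-monoʳ-≤-nonNeg (+ 4) le))
  where
  half : ∀ q → + 0 ℤ.≤ q → 0ℚᵘ ℚ.≤ q ℚ./ 2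
  half q h = *≤* (subst (+ 0 ℤ.≤_) (sym (ℤₚ.*-identityʳ q)) h)

halves⁻ : ∀ p z → NonNegative√ ((p ℚ./ 2) ⊕ (z ℚ./ 2) √5) → Halves p z
halves⁻ p z = λ where
    (inj₁ (h , *≤* le)) → inj₁ (half p h , ℤₚ.*-cancelʳ-≤-pos _ _ (+ 4) le)
    (inj₂ (h , *≤* le)) → inj₂ (half z h , ℤₚ.*-cancelʳ-≤-pos _ _ (+ 4) le)
  where
  half : ∀ q → 0ℚᵘ ℚ.≤ q ℚ./ 2 → + 0 ℤ.≤ q
  half q (*≤* h) = subst (+ 0 ℤ.≤_) (ℤₚ.*-identityʳ q) h

≤φ⁺ : ∀ z w → Halves (z ℤ.- + 2 ℤ.* w) z → fromℤ w ≤√ fromℤ z · φ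
≤φ⁺ z w h = NonNegative√-resp-≃ (ℚₚ.≃-sym (rat≃ z w)) (ℚₚ.≃-sym (irr≃ z w)) (halves⁺ _ z h)

≤φ⁻ : ∀ z w → fromℤ w ≤√ fromℤ z · φ → Halves (z ℤ.- + 2 ℤ.* w) z
≤φ⁻ z w h = halves⁻ _ z (NonNegative√-resp-≃ (rat≃ z w) (irr≃ z w) h)

0≤nφ : ∀ n → fromℤ (+ 0) ≤√ fromℤ (+ n) · φ
0≤nφ n = ≤φ⁺ (+ n) (+ 0) (inj₂ (ℤ.+≤+ z≤n , subst₂ ℤ._≤_ (eq₁ n) eq₂ (ℤ.+≤+ (ℕₚ.m≤n*m (n * n) 5))))
  where
  eq₁ : ∀ n → + (n * n) ≡ (+ n ℤ.- + 2 ℤ.* + 0) ℤ.* (+ n ℤ.- + 2 ℤ.* + 0)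
  eq₁ n = trans (ℤₚ.pos-* n n) (sym (cong (λ p → p ℤ.* p) (ℤₚ.+-identityʳ (+ n))))
  eq₂ : + (5 * (n * n)) ≡ + 5 ℤ.* (+ n ℤ.* + n)
  eq₂ = trans (ℤₚ.pos-* 5 (n * n)) (cong (+ 5 ℤ.*_) (ℤₚ.pos-* n n))

nφ<1+2n : ∀ n → fromℤ (+ n) · φ <√ fromℤ (+ suc (2 * n))
nφ<1+2n n le = absurd (≤φ⁻ (+ n) (+ suc (2 * n)) le)
  where
  p : ℤ
  p = + n ℤ.- + 2 ℤ.* + suc (2 * n)

  p≡ : p ≡ ℤ.- + suc (3 * n + 1)
  p≡ = begin
    + n ℤ.- + 2 ℤ.* + suc (2 * n)       ≡⟨ cong (λ x → + n ℤ.- + 2 ℤ.* (+ 1 ℤ.+ x)) (ℤₚ.pos-* 2 n) ⟩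
    + n ℤ.- + 2 ℤ.* (+ 1 ℤ.+ + 2 ℤ.* + n)      ≡⟨ eq (+ n) ⟩
    ℤ.- (+ 1 ℤ.+ (+ 3 ℤ.* + n ℤ.+ + 1))        ≡⟨ cong (λ x → ℤ.- (+ 1 ℤ.+ (x ℤ.+ + 1))) (ℤₚ.pos-* 3 n) ⟨
    ℤ.- + suc (3 * n + 1)               ∎
    where
    open ≡-Reasoning
    eq : ∀ z → z ℤ.- + 2 ℤ.* (+ 1 ℤ.+ + 2 ℤ.* z) ≡ ℤ.- (+ 1 ℤ.+ (+ 3 ℤ.* z ℤ.+ + 1))
    eq = ℤSolver.solve-∀

  5n² : + 5 ℤ.* (+ n ℤ.* + n) ≡ + (5 * (n * n))
  5n² = sym (trans (ℤₚ.pos-* 5 (n * n)) (cong (+ 5 ℤ.*_) (ℤₚ.pos-* n n)))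

  square : ∀ n → suc (3 * n + 1) * suc (3 * n + 1) ≡ suc (5 * (n * n)) + (4 * (n * n) + 12 * n + 3)
  square = solve-∀

  absurd : ¬ Halves p (+ n)
  absurd (inj₁ (0≤p , _)) with subst (+ 0 ℤ.≤_) p≡ 0≤p
  ... | ()
  absurd (inj₂ (_ , p²≤)) =
    ℕₚ.<⇒≱ (subst (5 * (n * n) <_) (sym (square n)) (ℕₚ.m≤m+n _ _))
           (ℤₚ.drop‿+≤+ (subst₂ ℤ._≤_ (cong (λ q → q ℤ.* q) p≡) 5n² p²≤))

⌊nφ⌋-isFloor : ∀ n → IsFloor (fromℤ (+ n) · φ) (+ ⌊ n φ⌋)
⌊nφ⌋-isFloor n = go (2 * n) (nφ<1+2n n)
  where
  go : ∀ k → fromℤ (+ n) · φ <√ fromℤ (+ suc k) → IsFloor (fromℤ (+ n) · φ) (+ searchFloor n k)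
  go zero    nφ< = record { lower = 0≤nφ n ; upper = nφ< }
  go (suc k) nφ< with fromℤ (+ suc k) ≤√? fromℤ (+ n) · φ
  ... | yes ≤nφ = record
    { lower = ≤nφ ; upper = subst (λ m → fromℤ (+ n) · φ <√ fromℤ (+ m)) (ℕₚ.+-comm 1 (suc k)) nφ< }
  ... | no  ≰nφ = go k ≰nφ

{-# OPTIONS --safe #-}
module Submission where

-- Appending a zero to a Zeckendorf expansion of m gives S m, and Sⁿ m obeys the
-- Fibonacci recurrence in n.  Since w < nφ is equivalent to wφ < n + w, induction on
-- the expansion from its least significant end yields S m + 1 < (m + 1)φ < S m + 2,
-- so ⌊(m + 1)φ⌋ = S m + 1.  The sign of ΔsZ N depends only on the last digits of N:
-- points of increase are those ending in 00, that is S² m; points of constancy those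
-- ending in 001 or 0010, that is S³ m + 1 or S⁴ m + 2; at all others the carry makes
-- N + 1 end in 000, so that N + 1 = S³ m with m ≥ 1.

open import Defs
open import Data.Nat.Base using (ℕ; NonZero; _≥_)
open import Data.Product.Base using (_×_; ∃-syntax)
open import Function.Base using (_∘_)
open import Level using (0ℓ)
open import Relation.Unary using (Pred; _≐_; _∪_)
open import Relation.Binary.PropositionalEquality using (_≡_)

open import Data.Nat.Base as ℕ using (zero; suc; pred; _≤_; _<_; z≤n; s≤s)
import Data.Nat.Properties as ℕₚ
open import Data.Nat.ListAction using (sum)
open import Data.Nat.ListAction.Properties using (sum-++)
open import Data.Nat.Tactic.RingSolver using (solve-∀)
open import Data.Integer.Base as ℤ using (ℤ; +_)
import Data.Integer.Properties as ℤₚ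
import Data.Integer.Tactic.RingSolver as ℤSolver
open import Data.Fin.Base using (toℕ)
open import Data.Fin.Patterns using (0F; 1F)
open import Data.List.Base using (List; []; _∷_; _++_; length; map)
open import Data.List.Properties using (length-++; length-replicate; map-++; ++-assoc; ++-identityʳ)
open import Data.List.Relation.Unary.Linked using (Linked; []; [-]; _∷_)
open import Data.Product.Base using (∃; _,_; proj₁; proj₂)
open import Data.Sum.Base using (inj₁; inj₂)
open import Data.Empty using (⊥-elim)
open import Relation.Nullary using (¬_; yes; no; contradiction)
open import Relation.Binary.Definitions using (tri<; tri≈; tri>)
open import Relation.Binary.PropositionalEquality
  using (refl; sym; trans; cong; cong₂; subst; subst₂; module ≡-Reasoning)

module _ where
  open import Data.Nat.Base using (_+_; _*_)

  -- Comparing integers with multiples of φ by quadratic inequalities.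

  -- Below n w, Below≤ n w and Above n w mean w < nφ, w ≤ nφ and nφ < w, by φ² = φ + 1.
  Below Below≤ Above : ℕ → ℕ → Set
  Below  n w = w * w < w * n + n * n
  Below≤ n w = w * w ≤ w * n + n * n
  Above  n w = w * n + n * n < w * w

  -- Dividing w < nφ by φ, where 1/φ = φ - 1, gives wφ < n + w. In quadratic form this only adds nw
  -- + w² to both sides.
  flip-below : ∀ n w → Below n w → Above w (n + w)
  flip-below n w h = subst₂ _<_ (l n w) (r n w) (ℕₚ.+-monoʳ-< (n * w + w * w) h)
    where
    l : ∀ n w → n * w + w * w + w * w ≡ (n + w) * w + w * w
    l = solve-∀
    r : ∀ n w → n * w + w * w + (w * n + n * n) ≡ (n + w) * (n + w)
    r = solve-∀

  flip-above : ∀ n w → Above n w → Below w (n + w)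
  flip-above n w h = subst₂ _<_ (l n w) (r n w) (ℕₚ.+-monoʳ-< (n * w + w * w) h)
    where
    l : ∀ n w → n * w + w * w + (w * n + n * n) ≡ (n + w) * (n + w)
    l = solve-∀
    r : ∀ n w → n * w + w * w + w * w ≡ (n + w) * w + w * w
    r = solve-∀

  below≤⇒≤2* : ∀ n w → Below≤ n w → w ≤ 2 * n
  below≤⇒≤2* n w h with w ℕₚ.≤? 2 * n
  ... | yes w≤2n = w≤2n
  ... | no  w≰2n = contradiction h (ℕₚ.<⇒≱ (begin-strict
      w * n + n * n          ≤⟨ ℕₚ.+-monoʳ-≤ (w * n) (ℕₚ.*-monoˡ-≤ n n≤w) ⟩
      w * n + w * n          ≡⟨ eq w n ⟩
      w * (2 * n)            <⟨ ℕₚ.*-monoʳ-< w {{ℕ.>-nonZero (ℕₚ.≤-<-trans z≤n 2n<w)}} 2n<w ⟩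
      w * w                  ∎))
    where
    open ℕₚ.≤-Reasoning
    2n<w : 2 * n < w
    2n<w = ℕₚ.≰⇒> w≰2n
    n≤w : n ≤ w
    n≤w = ℕₚ.≤-trans (ℕₚ.m≤n*m n 2) (ℕₚ.<⇒≤ 2n<w)
    eq : ∀ w n → w * n + w * n ≡ w * (2 * n)
    eq = solve-∀

  -- Since φ > 1, nφ grows by more than 1. The left side gains 2w + 1, the right side w + 3n + 2,
  -- and w ≤ 2n closes the gap; the spare n + 1 makes the conclusion strict.
  below-suc : ∀ n w → Below≤ n w → Below (suc n) (suc w)
  below-suc n w h = begin-strict
    suc w * suc w                              ≡⟨ l w ⟩
    w * w + (w + (1 + w))                      ≤⟨ ℕₚ.+-mono-≤ h (ℕₚ.+-monoʳ-≤ w (s≤s (below≤⇒≤2* n w h))) ⟩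
    w * n + n * n + (w + (1 + 2 * n))          <⟨ ℕₚ.m<m+n _ {suc n} (s≤s z≤n) ⟩
    w * n + n * n + (w + (1 + 2 * n)) + suc n  ≡⟨ r w n ⟩
    suc w * suc n + suc n * suc n              ∎
    where
    open ℕₚ.≤-Reasoning
    l : ∀ w → suc w * suc w ≡ w * w + (w + (1 + w))
    l = solve-∀
    r : ∀ w n → w * n + n * n + (w + (1 + 2 * n)) + suc n ≡ suc w * suc n + suc n * suc n
    r = solve-∀

  above-pred : ∀ n w → Above (suc n) (suc w) → Above n w
  above-pred n w h = ℕₚ.≰⇒> (λ w≤ → ℕₚ.<-asym h (below-suc n w w≤))

  below-monoˡ : ∀ {m n} w → m ≤ n → Below m w → Below n w
  below-monoˡ w m≤n h =
    ℕₚ.<-≤-trans h (ℕₚ.+-mono-≤ (ℕₚ.*-monoʳ-≤ w m≤n) (ℕₚ.*-mono-≤ m≤n m≤n))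

  -- The function w(w - n) is monotone only for w ≥ n, so v ≤ n is treated separately. Otherwise v =
  -- n + a and w = n + b, and (n + a)a ≤ (n + b)b ≤ n².
  below≤-antimonoʳ : ∀ n {v w} → v ≤ w → Below≤ n w → Below≤ n v
  below≤-antimonoʳ n {v} {w} v≤w h with ℕₚ.≤-total v n
  ... | inj₁ v≤n = ℕₚ.≤-trans (ℕₚ.*-monoʳ-≤ v v≤n) (ℕₚ.m≤m+n _ _)
  ... | inj₂ n≤v with ℕₚ.m≤n⇒∃[o]m+o≡n n≤v | ℕₚ.m≤n⇒∃[o]m+o≡n (ℕₚ.≤-trans n≤v v≤w)
  ... | a , refl | b , refl = begin
    (n + a) * (n + a)              ≡⟨ ℕₚ.*-distribˡ-+ (n + a) n a ⟩
    (n + a) * n + (n + a) * a      ≤⟨ ℕₚ.+-monoʳ-≤ _ (ℕₚ.*-mono-≤ v≤w (ℕₚ.+-cancelˡ-≤ n a b v≤w)) ⟩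
    (n + a) * n + (n + b) * b      ≤⟨ ℕₚ.+-monoʳ-≤ _ (ℕₚ.+-cancelˡ-≤ ((n + b) * n) _ _
                                       (subst (_≤ (n + b) * n + n * n) (ℕₚ.*-distribˡ-+ (n + b) n b) h)) ⟩
    (n + a) * n + n * n            ∎
    where open ℕₚ.≤-Reasoning

  below≤-above⇒< : ∀ n {w u} → Below≤ n w → Above n u → w < u
  below≤-above⇒< n b a = ℕₚ.≰⇒> (λ u≤w → ℕₚ.<⇒≱ a (below≤-antimonoʳ n u≤w b))

  -- Zeckendorf expansions as codes: values and digit sums.

  infixl 6 _·0 _·01

  -- Digit strings without two adjacent ones, read from the least significant end:
  -- every one is appended together with the zero to its left.
  data Code : Set where
    ε   : Code
    _·0  : Code → Code
    _·01 : Code → Code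

  -- `shift c` is the value after one more zero. The pair (`val c`, `shift c`) suffices: two zeros
  -- give their sum, and appending 01 is two zeros plus the weight 1, which the next shift turns
  -- into 2.
  val shift ones : Code → ℕ

  val ε       = 0
  val (c ·0)  = shift c
  val (c ·01) = suc (val c + shift c)

  shift ε       = 0
  shift (c ·0)  = val c + shift c
  shift (c ·01) = 2 + (val c + 2 * shift c)

  ones ε       = 0
  ones (c ·0)  = ones c
  ones (c ·01) = suc (ones c)

  code-digits : Code → List Digit
  code-digits ε       = []
  code-digits (c ·0)  = code-digits c ++ 0F ∷ []
  code-digits (c ·01) = code-digits c ++ 0F ∷ 1F ∷ []

  sparse-++0∷ : ∀ {ds es} → Linked NotBothOne ds → Linked NotBothOne es →
                Linked NotBothOne (ds ++ 0F ∷ es)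
  sparse-++0∷ []      k = sparse-0∷ k
  sparse-++0∷ [-]     k = (λ ()) ∷ sparse-0∷ k
  sparse-++0∷ (r ∷ l) k = r ∷ sparse-++0∷ l k

  code-sparse : ∀ c → Linked NotBothOne (code-digits c)
  code-sparse ε       = []
  code-sparse (c ·0)  = sparse-++0∷ (code-sparse c) []
  code-sparse (c ·01) = sparse-++0∷ (code-sparse c) [-]

  -- The zeros hold the place of `es`, so the digits of `ds` keep their weights.
  value-++ : ∀ ds es → value (ds ++ es) ≡ value (ds ++ 0s (length es)) + value es
  value-++ []       es = cong (_+ value es)
    (sym (trans (cong value (sym (++-identityʳ (0s (length es))))) (value-0s++ (length es) [])))
  value-++ (d ∷ ds) es = begin
    toℕ d * F (2 + length (ds ++ es)) + value (ds ++ es)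
      ≡⟨ cong₂ (λ k v → toℕ d * F (2 + k) + v) len (value-++ ds es) ⟩
    toℕ d * F (2 + length (ds ++ 0s (length es))) + (value (ds ++ 0s (length es)) + value es)
      ≡⟨ ℕₚ.+-assoc (toℕ d * F (2 + length (ds ++ 0s (length es)))) _ _ ⟨
    toℕ d * F (2 + length (ds ++ 0s (length es))) + value (ds ++ 0s (length es)) + value es
      ∎
    where
    open ≡-Reasoning
    len : length (ds ++ es) ≡ length (ds ++ 0s (length es))
    len = trans (length-++ ds)
      (trans (cong (λ k → length ds + k) (sym (length-replicate (length es)))) (sym (length-++ ds)))

  -- Each digit of `ds` has Fibonacci weights of consecutive indices in the three strings, so the
  -- recurrence holds digit by digit.
  value-++0s : ∀ k ds → value (ds ++ 0s (2 + k)) ≡ value (ds ++ 0s k) + value (ds ++ 0s (1 + k))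
  value-++0s zero    []       = refl
  value-++0s (suc k) []       = value-++0s k []
  value-++0s k       (d ∷ ds)
    rewrite length-++ ds {0s (2 + k)} | length-++ ds {0s (1 + k)} | length-++ ds {0s k}
          | ℕₚ.+-suc (length ds) (suc (length (0s k))) | ℕₚ.+-suc (length ds) (length (0s k))
          | value-++0s k ds
    = eq (toℕ d) (F (3 + (length ds + length (0s k)))) (F (2 + (length ds + length (0s k)))) _ _
    where
    eq : ∀ d f g x y → d * (f + g) + (x + y) ≡ d * g + x + (d * f + y)
    eq = solve-∀

  code-value  : ∀ c → value (code-digits c) ≡ val c
  shift-value : ∀ c → value (code-digits c ++ 0s 1) ≡ shift c

  code-value ε       = refl
  code-value (c ·0)  = shift-value c
  code-value (c ·01) = begin
    value (code-digits c ++ 0F ∷ 1F ∷ [])       ≡⟨ value-++ (code-digits c) (0F ∷ 1F ∷ []) ⟩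
    value (code-digits c ++ 0s 2) + 1           ≡⟨ cong (_+ 1) (value-++0s 0 (code-digits c)) ⟩
    value (code-digits c ++ []) + value (code-digits c ++ 0s 1) + 1
      ≡⟨ cong (λ ds → value ds + value (code-digits c ++ 0s 1) + 1) (++-identityʳ (code-digits c)) ⟩
    value (code-digits c) + value (code-digits c ++ 0s 1) + 1
      ≡⟨ cong₂ (λ x y → x + y + 1) (code-value c) (shift-value c) ⟩
    val c + shift c + 1                         ≡⟨ ℕₚ.+-comm _ 1 ⟩
    suc (val c + shift c)                       ∎
    where
    open ≡-Reasoning

  shift-value ε       = refl
  shift-value (c ·0)  = begin
    value ((code-digits c ++ 0s 1) ++ 0s 1)                        ≡⟨ cong value (++-assoc (code-digits c) _ _) ⟩
    value (code-digits c ++ 0s 2)                                  ≡⟨ value-++0s 0 (code-digits c) ⟩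
    value (code-digits c ++ []) + value (code-digits c ++ 0s 1)
      ≡⟨ cong₂ (λ ds v → value ds + v) (++-identityʳ (code-digits c)) (shift-value c) ⟩
    value (code-digits c) + shift c                                ≡⟨ cong (_+ shift c) (code-value c) ⟩
    val c + shift c                                                ∎
    where
    open ≡-Reasoning
  shift-value (c ·01) = begin
    value ((ds ++ 0F ∷ 1F ∷ []) ++ 0s 1)               ≡⟨ cong value (++-assoc ds _ _) ⟩
    value (ds ++ 0F ∷ 1F ∷ 0F ∷ [])                    ≡⟨ value-++ ds _ ⟩
    value (ds ++ 0s 3) + 2                             ≡⟨ cong (_+ 2) (value-++0s 1 ds) ⟩
    value (ds ++ 0s 1) + value (ds ++ 0s 2) + 2        ≡⟨ cong (λ v → value (ds ++ 0s 1) + v + 2) (value-++0s 0 ds) ⟩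
    value (ds ++ 0s 1) + (value (ds ++ []) + value (ds ++ 0s 1)) + 2
      ≡⟨ cong₂ (λ x y → x + (y + x) + 2) (shift-value c)
               (trans (cong value (++-identityʳ ds)) (code-value c)) ⟩
    shift c + (val c + shift c) + 2                    ≡⟨ eq (val c) (shift c) ⟩
    2 + (val c + 2 * shift c)                          ∎
    where
    open ≡-Reasoning
    ds = code-digits c
    eq : ∀ v s → s + (v + s) + 2 ≡ 2 + (v + 2 * s)
    eq = solve-∀

  digitSum-++ : ∀ ds es → digitSum (ds ++ es) ≡ digitSum ds + digitSum es
  digitSum-++ ds es = trans (cong sum (map-++ toℕ ds es)) (sum-++ (map toℕ ds) (map toℕ es))

  code-digitSum : ∀ c → digitSum (code-digits c) ≡ ones c
  code-digitSum ε       = refl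
  code-digitSum (c ·0)  = trans (digitSum-++ (code-digits c) _)
                            (trans (ℕₚ.+-identityʳ _) (code-digitSum c))
  code-digitSum (c ·01) = trans (digitSum-++ (code-digits c) _)
                            (trans (ℕₚ.+-comm _ 1) (cong suc (code-digitSum c)))

  sZ-code : ∀ c → sZ (val c) ≡ ones c
  sZ-code c = trans (sZ-unique (mkZeckendorf (code-digits c) (code-sparse c) (code-value c)))
                    (code-digitSum c)

  -- Successors of codes.

  -- The expansion of the number after `c ·0`: the last zero becomes a one. If `c` itself ends in a
  -- one, 011 is rewritten as 100 and the carry moves on to the prefix.
  suc0 : Code → Code
  suc0 ε       = ε ·01
  suc0 (c ·0)  = c ·01
  suc0 (c ·01) = suc0 c ·0 ·0

  val-suc0   : ∀ c → val (suc0 c) ≡ suc (shift c)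
  shift-suc0 : ∀ c → shift (suc0 c) ≡ 2 + (val c + shift c)

  val-suc0 ε       = refl
  val-suc0 (c ·0)  = refl
  val-suc0 (c ·01) = trans (cong₂ _+_ (val-suc0 c) (shift-suc0 c)) (eq (val c) (shift c))
    where
    eq : ∀ v s → suc s + (2 + (v + s)) ≡ suc (2 + (v + 2 * s))
    eq = solve-∀

  shift-suc0 ε       = refl
  shift-suc0 (c ·0)  = cong (λ k → 2 + k) (eq (val c) (shift c))
    where
    eq : ∀ v s → v + 2 * s ≡ s + (v + s)
    eq = solve-∀
  shift-suc0 (c ·01) =
    trans (cong₂ (λ x y → y + (x + y)) (val-suc0 c) (shift-suc0 c)) (eq (val c) (shift c))
    where
    eq : ∀ v s → 2 + (v + s) + (suc s + (2 + (v + s))) ≡ 2 + (suc (v + s) + (2 + (v + 2 * s)))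
    eq = solve-∀

  ones-suc0 : ∀ c → ones (suc0 c) ≤ suc (ones c)
  ones-suc0 ε       = ℕₚ.≤-refl
  ones-suc0 (c ·0)  = ℕₚ.≤-refl
  ones-suc0 (c ·01) = ℕₚ.m≤n⇒m≤1+n (ones-suc0 c)

  code-suc : ∀ c → ∃ λ d → val d ≡ suc (val c)
  code-suc ε       = ε ·01 , refl
  code-suc (c ·0)  = suc0 c , val-suc0 c
  -- 01 becomes 10: the prefix takes a last digit one, carrying if necessary, and a zero follows.
  code-suc (c ·01) = suc0 c ·0 , shift-suc0 c

  code : ∀ N → ∃ λ c → val c ≡ N
  code zero    = ε , refl
  code (suc N) with code N
  ... | c , refl = code-suc c

  -- The shift map and its bounds by multiples of φ.

  -- Defined through a chosen code; `S-val` shows that every code of the same number gives the same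
  -- result.
  S : ℕ → ℕ
  S m = shift (proj₁ (code m))

  record Bracket (v s : ℕ) : Set where
    constructor bracket
    field
      below : Below (suc v) (suc s)
      above : Above (suc v) (2 + s)

  -- Flipping turns a bound on (v + 1)φ into the opposite bound on (s + 1)φ. The upper bound is
  -- first lowered to vφ < s + 1, since φ > 1.
  bracket-·0 : ∀ v s → Bracket v s → Bracket s (v + s)
  bracket-·0 v s (bracket b a) = bracket
    (subst (Below (suc s)) (ℕₚ.+-suc v s) (flip-above v (suc s) (above-pred v (suc s) a)))
    (subst (Above (suc s)) (cong suc (ℕₚ.+-suc v s)) (flip-below (suc v) (suc s) b))

  -- The last digit is now a one, so all arguments are larger by one: the upper bound flips as it
  -- stands, and the lower one is first raised to s + 2 < (v + 2)φ.
  bracket-·1 : ∀ v s → Bracket v s → Bracket (suc s) (2 + (v + s))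
  bracket-·1 v s (bracket b a) = bracket
    (subst (Below (2 + s)) (eq v s) (flip-above (suc v) (2 + s) a))
    (subst (Above (2 + s)) (cong suc (eq v s))
      (flip-below (2 + v) (2 + s) (below-suc (suc v) (suc s) (ℕₚ.<⇒≤ b))))
    where
    eq : ∀ v s → suc v + (2 + s) ≡ 3 + (v + s)
    eq = solve-∀

  code-bracket : ∀ c → Bracket (val c) (shift c)
  code-bracket ε       = bracket (s≤s (s≤s z≤n)) (s≤s (s≤s (s≤s (s≤s z≤n))))
  code-bracket (c ·0)  = bracket-·0 _ _ (code-bracket c)
  code-bracket (c ·01) = subst (Bracket (suc (val c + shift c))) (cong (λ k → 2 + k) (eq (val c) (shift c)))
    (bracket-·1 _ _ (bracket-·0 _ _ (code-bracket c)))
    where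
    eq : ∀ v s → s + (v + s) ≡ v + 2 * s
    eq = solve-∀

  -- By the brackets, `shift c` + 1 is the floor of (`val c` + 1)φ, which depends monotonically on
  -- `val c` alone.
  shift-mono-≤ : ∀ c d → val c ≤ val d → shift c ≤ shift d
  shift-mono-≤ c d v≤v′ = ℕₚ.≤-pred (ℕₚ.≤-pred (below≤-above⇒< (suc (val d))
    (ℕₚ.<⇒≤ (below-monoˡ (suc (shift c)) (s≤s v≤v′) (Bracket.below (code-bracket c))))
    (Bracket.above (code-bracket d))))

  shift-mono-< : ∀ c d → val c < val d → shift c < shift d
  shift-mono-< c d v<v′ = ℕₚ.≤-pred (ℕₚ.≤-pred (below≤-above⇒< (suc (val d))
    (ℕₚ.<⇒≤ (below-monoˡ (2 + shift c) (s≤s v<v′)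
      (below-suc (suc (val c)) (suc (shift c)) (ℕₚ.<⇒≤ (Bracket.below (code-bracket c))))))
    (Bracket.above (code-bracket d))))

  S-val : ∀ c → S (val c) ≡ shift c
  S-val c with code (val c)
  ... | d , eq = ℕₚ.≤-antisym (shift-mono-≤ d c (ℕₚ.≤-reflexive eq))
                              (shift-mono-≤ c d (ℕₚ.≤-reflexive (sym eq)))

  S-step : ∀ m → S m < S (suc m)
  S-step m = shift-mono-< c d (ℕₚ.≤-reflexive (trans (cong suc (proj₂ (code m))) (sym (proj₂ (code (suc m))))))
    where
    c = proj₁ (code m)
    d = proj₁ (code (suc m))

  -- The floor of nφ in terms of the shift.

  -- Twice nφ - w is (n - 2w) + n√5, nonnegative once (n - 2w)² ≤ 5n²; and 5n² - (n - 2w)² = 4(wn +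
  -- n² - w²).
  Below≤⇒≤φ : ∀ n w → Below≤ n w → fromℤ (+ w) ≤√ fromℤ (+ n) · φ
  Below≤⇒≤φ n w h = ≤φ⁺ (+ n) (+ w) (inj₂ (ℤ.+≤+ z≤n , ℤₚ.0≤i-j⇒j≤i (subst (+ 0 ℤ.≤_) (eq (+ n) (+ w))
      (ℤₚ.*-monoˡ-≤-nonNeg (+ 4) (ℤₚ.i≤j⇒0≤j-i hℤ)))))
    where
    hℤ : + w ℤ.* + w ℤ.≤ + w ℤ.* + n ℤ.+ + n ℤ.* + n
    hℤ = subst₂ ℤ._≤_ (ℤₚ.pos-* w w) (cong₂ ℤ._+_ (ℤₚ.pos-* w n) (ℤₚ.pos-* n n)) (ℤ.+≤+ h)
    eq : ∀ n w → + 4 ℤ.* (w ℤ.* n ℤ.+ n ℤ.* n ℤ.- w ℤ.* w)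
               ≡ + 5 ℤ.* (n ℤ.* n) ℤ.- (n ℤ.- + 2 ℤ.* w) ℤ.* (n ℤ.- + 2 ℤ.* w)
    eq = ℤSolver.solve-∀

  ≤φ⇒Below≤ : ∀ n w → fromℤ (+ w) ≤√ fromℤ (+ n) · φ → Below≤ n w
  ≤φ⇒Below≤ n w h with ≤φ⁻ (+ n) (+ w) h
  -- Here n - 2w ≥ 0, so w ≤ n and w² ≤ wn already.
  ... | inj₁ (2w≤n , _) = ℕₚ.≤-trans (ℕₚ.*-monoʳ-≤ w w≤n) (ℕₚ.m≤m+n _ _)
    where
    w≤n : w ≤ n
    w≤n = ℕₚ.≤-trans (ℕₚ.m≤n*m w 2)
      (ℤₚ.drop‿+≤+ (subst (ℤ._≤ + n) (sym (ℤₚ.pos-* 2 w)) (ℤₚ.0≤i-j⇒j≤i 2w≤n)))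
  ... | inj₂ (_ , le) = ℤₚ.drop‿+≤+ (subst₂ ℤ._≤_ (sym (ℤₚ.pos-* w w))
      (sym (cong₂ ℤ._+_ (ℤₚ.pos-* w n) (ℤₚ.pos-* n n)))
      (ℤₚ.0≤i-j⇒j≤i (ℤₚ.*-cancelˡ-≤-pos (+ 0) _ (+ 4) (subst (+ 0 ℤ.≤_) (eq (+ n) (+ w)) (ℤₚ.i≤j⇒0≤j-i le)))))
    where
    eq : ∀ n w → + 5 ℤ.* (n ℤ.* n) ℤ.- (n ℤ.- + 2 ℤ.* w) ℤ.* (n ℤ.- + 2 ℤ.* w)
               ≡ + 4 ℤ.* (w ℤ.* n ℤ.+ n ℤ.* n ℤ.- w ℤ.* w)
    eq = ℤSolver.solve-∀

  ⌊φ⌋-unique : ∀ n w → Below≤ n w → Above n (suc w) → ⌊ n φ⌋ ≡ w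
  ⌊φ⌋-unique n w b a = ℕₚ.≤-antisym
    (ℕₚ.≤-pred (below≤-above⇒< n (≤φ⇒Below≤ n ⌊ n φ⌋ (IsFloor.lower isFloor)) a))
    (ℕₚ.≮⇒≥ λ ⌊⌋<w → IsFloor.upper isFloor (subst (λ k → fromℤ (+ k) ≤√ fromℤ (+ n) · φ) (ℕₚ.+-comm 1 ⌊ n φ⌋)
      (Below≤⇒≤φ n (suc ⌊ n φ⌋) (below≤-antimonoʳ n ⌊⌋<w b))))
    where isFloor = ⌊nφ⌋-isFloor n

  ⌊suc-val⌋ : ∀ c → ⌊ suc (val c) φ⌋ ≡ suc (shift c)
  ⌊suc-val⌋ c = ⌊φ⌋-unique (suc (val c)) (suc (shift c))
    (ℕₚ.<⇒≤ (Bracket.below (code-bracket c))) (Bracket.above (code-bracket c))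

  ⌊suc-φ⌋ : ∀ m → ⌊ suc m φ⌋ ≡ suc (S m)
  ⌊suc-φ⌋ m with code m
  ... | c , refl = ⌊suc-val⌋ c

  -- The sign of `ΔsZ` from the last digits.

  sZ-<⇒increase : ∀ N → sZ N < sZ (suc N) → Increase N
  sZ-<⇒increase N h rewrite ℕₚ.+-comm N 1 =
    subst (ℤ._< + sZ (suc N) ℤ.- + sZ N) (ℤₚ.+-inverseʳ (+ sZ N)) (ℤₚ.+-monoˡ-< (ℤ.- + sZ N) (ℤ.+<+ h))

  sZ-≡⇒constancy : ∀ N → sZ (suc N) ≡ sZ N → Constancy N
  sZ-≡⇒constancy N h rewrite ℕₚ.+-comm N 1 = ℤₚ.i≡j⇒i-j≡0 (cong +_ h)

  sZ->⇒decrease : ∀ N → sZ (suc N) < sZ N → Decrease N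
  sZ->⇒decrease N h rewrite ℕₚ.+-comm N 1 =
    subst (+ sZ (suc N) ℤ.- + sZ N ℤ.<_) (ℤₚ.+-inverseʳ (+ sZ N)) (ℤₚ.+-monoˡ-< (ℤ.- + sZ N) (ℤ.+<+ h))

  increase-00 : ∀ c → Increase (val (c ·0 ·0))
  increase-00 c = sZ-<⇒increase (val (c ·0 ·0)) (ℕₚ.≤-reflexive
    (trans (cong suc (sZ-code (c ·0 ·0))) (sym (sZ-code (c ·01)))))

  -- 001 becomes 010: the one moves up a place without touching another one.
  constancy-001 : ∀ c → Constancy (val (c ·0 ·01))
  constancy-001 c = sZ-≡⇒constancy (val (c ·0 ·01)) (trans (cong sZ (eq (val c) (shift c)))
    (trans (sZ-code (c ·01 ·0)) (sym (sZ-code (c ·0 ·01)))))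
    where
    eq : ∀ v s → suc (suc (s + (v + s))) ≡ 2 + (v + 2 * s)
    eq = solve-∀

  constancy-0010 : ∀ c → Constancy (val (c ·0 ·01 ·0))
  constancy-0010 c = sZ-≡⇒constancy (val (c ·0 ·01 ·0)) (trans (cong sZ (eq (val c) (shift c)))
    (trans (sZ-code (c ·01 ·0 ·0)) (sym (sZ-code (c ·0 ·01 ·0)))))
    where
    eq : ∀ v s → suc (2 + (s + 2 * (v + s))) ≡ suc (v + s) + (2 + (v + 2 * s))
    eq = solve-∀

  decrease-carry : ∀ c d → suc (val d) ≡ val (c ·0 ·0 ·0) → ones c < ones d → Decrease (val d)
  decrease-carry c d eq h = sZ->⇒decrease (val d)
    (subst₂ _<_ (sym (trans (cong sZ eq) (sZ-code (c ·0 ·0 ·0)))) (sym (sZ-code d)) h)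

  -- `carries` stores both the sign of `ΔsZ N`, for excluding cases, and the form of N + 1, for the
  -- enumeration.
  data Class (N : ℕ) : Set where
    ends00   : ∀ c → N ≡ val (c ·0 ·0)     → Class N
    ends001  : ∀ c → N ≡ val (c ·0 ·01)    → Class N
    ends0010 : ∀ c → N ≡ val (c ·0 ·01 ·0) → Class N
    carries  : ∀ c → suc N ≡ val (c ·0 ·0 ·0) → Decrease N → Class N

  -- Short codes are padded with leading zeros, which do not change the value.
  classify-code : ∀ c → Class (val c)
  classify-code ε              = ends00 ε refl
  classify-code (ε ·0)         = ends00 ε refl
  classify-code (c ·0 ·0)      = ends00 c refl
  classify-code (ε ·01 ·0)     = ends0010 ε refl
  classify-code (c ·0 ·01 ·0)  = ends0010 c refl
  -- 01010 becomes 10000: two ones disappear, and the carry into the prefix adds at most one.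
  classify-code (c ·01 ·01 ·0) =
    carries (suc0 c ·0) eq (decrease-carry (suc0 c ·0) (c ·01 ·01 ·0) eq (s≤s (ones-suc0 c)))
    where
    ring : ∀ v s → suc s + (2 + (v + s)) ≡ suc (2 + (v + 2 * s))
    ring = solve-∀
    eq : suc (val (c ·01 ·01 ·0)) ≡ val (suc0 (c ·01) ·0 ·0)
    eq = sym (trans (cong₂ _+_ (val-suc0 (c ·01)) (shift-suc0 (c ·01)))
                    (ring (val (c ·01)) (shift (c ·01))))
  classify-code (ε ·01)        = ends001 ε refl
  classify-code (c ·0 ·01)     = ends001 c refl
  -- Likewise 0101 becomes 1000.
  classify-code (c ·01 ·01)    =
    carries (suc0 c) eq (decrease-carry (suc0 c) (c ·01 ·01) eq (s≤s (ones-suc0 c)))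
    where
    eq : suc (val (c ·01 ·01)) ≡ val (suc0 (c ·01) ·0)
    eq = sym (shift-suc0 (c ·01))

  classify : ∀ N → Class N
  classify N with code N
  ... | c , refl = classify-code c

  -- Values of S³ follow points of decrease.

  val-000-mono : ∀ c d → val c ≤ val d → val (c ·0 ·0 ·0) ≤ val (d ·0 ·0 ·0)
  val-000-mono c d h = ℕₚ.+-mono-≤ (shift-mono-≤ c d h) (ℕₚ.+-mono-≤ h (shift-mono-≤ c d h))

  -- S³ d is S² at S d, and consecutive values of S² differ by at least 2, so S² m + 1 is skipped.
  000≢suc-00 : ∀ c d → ¬ val (d ·0 ·0 ·0) ≡ suc (val (c ·0 ·0))
  000≢suc-00 c d eq with val (d ·0) ℕₚ.≤? val c
  ... | yes d≤c = ℕₚ.<⇒≱ (ℕₚ.≤-reflexive (sym eq)) (ℕₚ.+-mono-≤ d≤c (shift-mono-≤ (d ·0) c d≤c))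
  ... | no  d≰c = ℕₚ.<⇒≢ (begin-strict
      suc (val c + shift c)        <⟨ ℕₚ.n<1+n _ ⟩
      2 + (val c + shift c)        ≡⟨ cong suc (ℕₚ.+-suc (val c) (shift c)) ⟨
      suc (val c) + suc (shift c)  ≤⟨ ℕₚ.+-mono-≤ c<d (shift-mono-< c (d ·0) c<d) ⟩
      val (d ·0 ·0 ·0)             ∎) (sym eq)
    where
    open ℕₚ.≤-Reasoning
    c<d : val c < val (d ·0)
    c<d = ℕₚ.≰⇒> d≰c

  -- Consecutive values of S³ differ by at least 3, so S³ m + 2 is skipped.
  000≢suc-001 : ∀ c d → ¬ val (d ·0 ·0 ·0) ≡ suc (val (c ·0 ·01))
  000≢suc-001 c d eq with val d ℕₚ.≤? val c
  ... | yes d≤c = ℕₚ.<⇒≱ (ℕₚ.<-≤-trans (ℕₚ.m<n+m _ {2} (s≤s z≤n)) (ℕₚ.≤-reflexive (sym eq)))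
                          (val-000-mono d c d≤c)
  ... | no  d≰c = ℕₚ.<⇒≢ (begin-strict
      2 + (shift c + (val c + shift c))                <⟨ ℕₚ.n<1+n _ ⟩
      3 + (shift c + (val c + shift c))                ≡⟨ ring (val c) (shift c) ⟨
      suc (shift c) + (suc (val c) + suc (shift c))    ≤⟨ ℕₚ.+-mono-≤ s<s′ (ℕₚ.+-mono-≤ c<d s<s′) ⟩
      val (d ·0 ·0 ·0)                                 ∎) (sym eq)
    where
    open ℕₚ.≤-Reasoning
    c<d : val c < val d
    c<d = ℕₚ.≰⇒> d≰c
    s<s′ : shift c < shift d
    s<s′ = shift-mono-< c d c<d
    ring : ∀ v s → suc s + (suc v + suc s) ≡ 3 + (s + (v + s))
    ring = solve-∀

  -- The number in question is S³(S m) + 3. A gap of 3 would not exclude it, but `suc0` gives the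
  -- exact next value S³(S m + 1) = S³(S m) + 5.
  000≢suc-0010 : ∀ c d → ¬ val (d ·0 ·0 ·0) ≡ suc (val (c ·0 ·01 ·0))
  000≢suc-0010 c d eq with val d ℕₚ.≤? val (c ·0)
  ... | yes d≤c0 = ℕₚ.<⇒≢ (begin-strict
      val (d ·0 ·0 ·0)                           ≤⟨ val-000-mono d (c ·0) d≤c0 ⟩
      val (c ·0 ·0 ·0 ·0)                        <⟨ ℕₚ.m<n+m _ {3} (s≤s z≤n) ⟩
      3 + val (c ·0 ·0 ·0 ·0)                    ≡⟨ ring (val c) (shift c) ⟩
      suc (val (c ·0 ·01 ·0))                    ∎) eq
    where
    open ℕₚ.≤-Reasoning
    ring : ∀ v s → 3 + (v + s + (s + (v + s))) ≡ suc (2 + (s + 2 * (v + s)))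
    ring = solve-∀
  ... | no  d≰c0 = ℕₚ.<⇒≢ (begin-strict
      suc (val (c ·0 ·01 ·0))                      <⟨ ℕₚ.m<n+m _ {2} (s≤s z≤n) ⟩
      2 + suc (val (c ·0 ·01 ·0))                  ≡⟨ ring (val c) (shift c) ⟩
      2 + (val c + shift c) + (suc (shift c) + (2 + (val c + shift c)))
        ≡⟨ cong₂ (λ v s → s + (v + s)) (val-suc0 c) (shift-suc0 c) ⟨
      val (suc0 c ·0 ·0 ·0)                        ≤⟨ val-000-mono (suc0 c) d
                                                        (subst (_≤ val d) (sym (val-suc0 c)) (ℕₚ.≰⇒> d≰c0)) ⟩
      val (d ·0 ·0 ·0)                             ∎) (sym eq)
    where
    open ℕₚ.≤-Reasoning
    ring : ∀ v s → 2 + suc (2 + (s + 2 * (v + s))) ≡ 2 + (v + s) + (suc s + (2 + (v + s)))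
    ring = solve-∀

  decrease-000 : ∀ {N} d → suc N ≡ val (d ·0 ·0 ·0) → Decrease N
  decrease-000 {N} d eq with classify N
  ... | ends00   c refl  = ⊥-elim (000≢suc-00 c d (sym eq))
  ... | ends001  c refl  = ⊥-elim (000≢suc-001 c d (sym eq))
  ... | ends0010 c refl  = ⊥-elim (000≢suc-0010 c d (sym eq))
  ... | carries  _ _ dec = dec

  -- Increasing enumerations and their uniqueness.

  enumerate : ∀ {P : Pred ℕ 0ℓ} (f : ℕ → ℕ) → (∀ m → f m < f (suc m)) → (∀ m → P (f m)) →
              (∀ {N} → P N → ∃ λ k → f k ≡ N) → IsIncreasingEnumeration P (λ n → f (pred n))
  enumerate f step sound complete = record
    { increasing = λ where (suc m) (suc n) (s≤s m<n) → mono m n m<n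
    ; sound      = λ n → sound (pred n)
    ; complete   = complete
    }
    where
    mono : ∀ m n → m < n → f m < f n
    mono m (suc n) (s≤s m≤n) with ℕₚ.m≤n⇒m<n∨m≡n m≤n
    ... | inj₁ m<n  = ℕₚ.<-trans (mono m n m<n) (step n)
    ... | inj₂ refl = step n

  -- The terms of `b` occur in `a` at strictly increasing positions, so the position of each is at
  -- least its own index.
  enumeration-≤ : ∀ {P a b} → IsIncreasingEnumeration P a → IsIncreasingEnumeration P b →
                  ∀ k → a (suc k) ≤ b (suc k)
  enumeration-≤ {P} {a} {b} ea eb k with index k
    where
    module A = IsIncreasingEnumeration ea
    module B = IsIncreasingEnumeration eb
    index : ∀ k → ∃ λ j → k ≤ j × a (suc j) ≡ b (suc k)
    index zero with A.complete (B.sound 1)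
    ... | j , eq = j , z≤n , eq
    index (suc k) with index k | A.complete (B.sound (2 + k))
    ... | i , k≤i , eqᵢ | j , eqⱼ = j , ℕₚ.≤-<-trans k≤i i<j , eqⱼ
      where
      bₖ<bₖ₊₁ : b (suc k) < b (2 + k)
      bₖ<bₖ₊₁ = B.increasing (suc k) (2 + k) ℕₚ.≤-refl
      i<j : i < j
      i<j with ℕₚ.<-cmp i j
      ... | tri< i<j _ _ = i<j
      ... | tri≈ _ refl _ = ⊥-elim (ℕₚ.<⇒≢ bₖ<bₖ₊₁ (trans (sym eqᵢ) eqⱼ))
      ... | tri> _ _ j<i = ⊥-elim (ℕₚ.<-asym bₖ<bₖ₊₁
              (subst₂ _<_ eqⱼ eqᵢ (A.increasing (suc j) (suc i) (s≤s j<i))))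
  ... | j , k≤j , eq with ℕₚ.m≤n⇒m<n∨m≡n k≤j
  ... | inj₂ refl = ℕₚ.≤-reflexive eq
  ... | inj₁ k<j  = ℕₚ.<⇒≤ (subst (a (suc k) <_) eq
          (IsIncreasingEnumeration.increasing ea (suc k) (suc j) (s≤s k<j)))

  enumeration-unique : ∀ {P a b} → IsIncreasingEnumeration P a → IsIncreasingEnumeration P b →
                       ∀ k → a (suc k) ≡ b (suc k)
  enumeration-unique ea eb k = ℕₚ.≤-antisym (enumeration-≤ ea eb k) (enumeration-≤ eb ea k)

  -- By the Fibonacci recurrence m + S m is S² m, the expansion of m followed by 00.
  increase-enumeration : IsIncreasingEnumeration Increase (λ n → pred n + S (pred n))
  increase-enumeration = enumerate (λ m → m + S m)
    (λ m → s≤s (ℕₚ.+-monoʳ-≤ m (ℕₚ.<⇒≤ (S-step m)))) sound complete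
    where
    sound : ∀ m → Increase (m + S m)
    sound m with code m
    ... | c , refl = increase-00 c
    complete : ∀ {N} → Increase N → ∃ λ k → k + S k ≡ N
    complete {N} inc with classify N
    ... | ends00   c refl  = val c , cong (λ s → val c + s) (S-val c)
    ... | ends001  c refl  = ⊥-elim (ℤₚ.<⇒≢ inc (sym (constancy-001 c)))
    ... | ends0010 c refl  = ⊥-elim (ℤₚ.<⇒≢ inc (sym (constancy-0010 c)))
    ... | carries  _ _ dec = ⊥-elim (ℤₚ.<-asym inc dec)

  -- With k = m + 1, S³ k = k + 2 S k, and its predecessor is m + 2 S(m + 1). The value k = 0 is
  -- left out because S³ 0 = 0 has no predecessor.
  decrease-enumeration : IsIncreasingEnumeration Decrease (λ n → pred n + 2 * S (suc (pred n)))
  decrease-enumeration = enumerate (λ m → m + 2 * S (suc m))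
    (λ m → s≤s (ℕₚ.+-monoʳ-≤ m (ℕₚ.*-monoʳ-≤ 2 (ℕₚ.<⇒≤ (S-step (suc m)))))) sound complete
    where
    ring : ∀ v s → v + 2 * s ≡ s + (v + s)
    ring = solve-∀
    sound : ∀ m → Decrease (m + 2 * S (suc m))
    sound m = decrease-000 d (trans (ring (suc m) (shift d))
                                    (cong (λ v → shift d + (v + shift d)) (sym (proj₂ (code (suc m))))))
      where d = proj₁ (code (suc m))
    complete : ∀ {N} → Decrease N → ∃ λ k → k + 2 * S (suc k) ≡ N
    complete {N} dec with classify N
    ... | ends00   c refl  = ⊥-elim (ℤₚ.<-asym dec (increase-00 c))
    ... | ends001  c refl  = ⊥-elim (ℤₚ.<⇒≢ dec (constancy-001 c))
    ... | ends0010 c refl  = ⊥-elim (ℤₚ.<⇒≢ dec (constancy-0010 c))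
    ... | carries  c eq _  = go (val c) refl
      where
      go : ∀ v → val c ≡ v → ∃ λ k → k + 2 * S (suc k) ≡ N
      go zero    c≡0 = ⊥-elim (ℕₚ.1+n≰n {N} (ℕₚ.≤-trans (ℕₚ.≤-reflexive eq)
        (ℕₚ.≤-trans (val-000-mono c ε (ℕₚ.≤-reflexive c≡0)) z≤n)))
      go (suc k) c≡  = k , ℕₚ.suc-injective (begin
        suc k + 2 * S (suc k)        ≡⟨ cong (λ v → v + 2 * S v) c≡ ⟨
        val c + 2 * S (val c)        ≡⟨ cong (λ s → val c + 2 * s) (S-val c) ⟩
        val c + 2 * shift c          ≡⟨ ring (val c) (shift c) ⟩
        val (c ·0 ·0 ·0)             ≡⟨ eq ⟨
        suc N                        ∎)
        where open ≡-Reasoning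

-- The closed formulas over the integers.

open import Data.Integer.Base using (_+_; _*_; _-_)

+-∸ : ∀ k {a b} → a ≡ k ℕ.+ b → + a - + k ≡ + b
+-∸ k {_} {b} refl = trans (ℤₚ.m-n≡m⊖n (k ℕ.+ b) k)
  (trans (ℤₚ.⊖-≥ (ℕₚ.m≤m+n k b)) (cong +_ (ℕₚ.m+n∸m≡n k b)))

-- This and the next two substitute n = m + 1 and ⌊nφ⌋ = S m + 1 into S² m = m + S m, S³ m + 1 = m +
-- 2 S m + 1 and S⁴ m + 2 = 2m + 3 S m + 2.
increase-formula : ∀ m → + ⌊ suc m φ⌋ + + suc m - + 2 ≡ + (m ℕ.+ S m)
increase-formula m = +-∸ 2 (trans (cong (ℕ._+ suc m) (⌊suc-φ⌋ m)) (eq m (S m)))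
  where
  eq : ∀ m s → suc s ℕ.+ suc m ≡ 2 ℕ.+ (m ℕ.+ s)
  eq = solve-∀

001-formula : ∀ c → + 2 * + ⌊ suc (val c) φ⌋ + + suc (val c) - + 2 ≡ + val (c ·0 ·01)
001-formula c = trans (cong (λ z → z + + suc (val c) - + 2) (sym (ℤₚ.pos-* 2 ⌊ suc (val c) φ⌋)))
  (+-∸ 2 (trans (cong (λ b → 2 ℕ.* b ℕ.+ suc (val c)) (⌊suc-val⌋ c)) (eq (val c) (shift c))))
  where
  eq : ∀ v s → 2 ℕ.* suc s ℕ.+ suc v ≡ 2 ℕ.+ suc (s ℕ.+ (v ℕ.+ s))
  eq = solve-∀

0010-formula : ∀ c → + 3 * + ⌊ suc (val c) φ⌋ + + 2 * + suc (val c) - + 3 ≡ + val (c ·0 ·01 ·0)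
0010-formula c = trans
  (cong₂ (λ y z → y + z - + 3) (sym (ℤₚ.pos-* 3 ⌊ suc (val c) φ⌋)) (sym (ℤₚ.pos-* 2 (suc (val c)))))
  (+-∸ 3 (trans (cong (λ b → 3 ℕ.* b ℕ.+ 2 ℕ.* suc (val c)) (⌊suc-val⌋ c)) (eq (val c) (shift c))))
  where
  eq : ∀ v s → 3 ℕ.* suc s ℕ.+ 2 ℕ.* suc v ≡ 3 ℕ.+ (2 ℕ.+ (s ℕ.+ 2 ℕ.* (v ℕ.+ s)))
  eq = solve-∀

-- The index is m + 2 because the initial term -1 shifts the enumeration by one place.
decrease-formula : ∀ m → + 2 * + ⌊ 2 ℕ.+ m φ⌋ + + (2 ℕ.+ m) - + 4 ≡ + (m ℕ.+ 2 ℕ.* S (suc m))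
decrease-formula m = trans (cong (λ z → z + + (2 ℕ.+ m) - + 4) (sym (ℤₚ.pos-* 2 ⌊ 2 ℕ.+ m φ⌋)))
  (+-∸ 4 (trans (cong (λ b → 2 ℕ.* b ℕ.+ (2 ℕ.+ m)) (⌊suc-φ⌋ (suc m))) (eq m (S (suc m)))))
  where
  eq : ∀ m s → 2 ℕ.* suc s ℕ.+ (2 ℕ.+ m) ≡ 4 ℕ.+ (m ℕ.+ 2 ℕ.* s)
  eq = solve-∀

theorem2 :
    let U : Pred ℤ 0ℓ
        U = (λ z → ∃[ n ] n ≥ 1 × z ≡ + 2 * + ⌊ n φ⌋ + + n - + 2)
          ∪ (λ z → ∃[ n ] n ≥ 1 × z ≡ + 3 * + ⌊ n φ⌋ + + 2 * + n - + 3)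
    in
      (∀ n .{{_ : NonZero n}} → + IZ n ≡ + ⌊ n φ⌋ + + n - + 2)
    × ((λ z → ∃[ N ] z ≡ + N × Constancy N) ≐ U)
    × IsIncreasingEnumeration (U ∘ +_) CZ
    × (∀ n .{{_ : NonZero n}} → DZ n ≡ + 2 * + ⌊ n φ⌋ + + n - + 4)
theorem2 = increase , (constancy⊆U , U⊆constancy) , constancy , decrease
  where
  U : Pred ℤ 0ℓ
  U = (λ z → ∃[ n ] n ≥ 1 × z ≡ + 2 * + ⌊ n φ⌋ + + n - + 2)
    ∪ (λ z → ∃[ n ] n ≥ 1 × z ≡ + 3 * + ⌊ n φ⌋ + + 2 * + n - + 3)

  increase : ∀ n .{{_ : NonZero n}} → + IZ n ≡ + ⌊ n φ⌋ + + n - + 2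
  increase (suc m) = trans
    (cong +_ (enumeration-unique (Enumeration.nth-isIncreasingEnumeration increase? increase-unbounded)
                                 increase-enumeration m))
    (sym (increase-formula m))

  constancy⊆U : ∀ {z} → (∃[ N ] z ≡ + N × Constancy N) → U z
  constancy⊆U (N , refl , con) with classify N
  ... | ends00   c refl  = ⊥-elim (ℤₚ.<⇒≢ (increase-00 c) (sym con))
  ... | ends001  c refl  = inj₁ (suc (val c) , s≤s z≤n , sym (001-formula c))
  ... | ends0010 c refl  = inj₂ (suc (val c) , s≤s z≤n , sym (0010-formula c))
  ... | carries  _ _ dec = ⊥-elim (ℤₚ.<⇒≢ dec con)

  U⊆constancy : ∀ {z} → U z → ∃[ N ] z ≡ + N × Constancy N
  U⊆constancy (inj₁ (suc m , _ , refl)) with code m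
  ... | c , refl = val (c ·0 ·01) , 001-formula c , constancy-001 c
  U⊆constancy (inj₂ (suc m , _ , refl)) with code m
  ... | c , refl = val (c ·0 ·01 ·0) , 0010-formula c , constancy-0010 c

  constancy : IsIncreasingEnumeration (U ∘ +_) CZ
  constancy = record
    { increasing = C.increasing
    ; sound      = λ n → constancy⊆U (CZ n , refl , C.sound n)
    ; complete   = λ u → C.complete (fromU (U⊆constancy u))
    }
    where
    module C = IsIncreasingEnumeration
      (Enumeration.nth-isIncreasingEnumeration constancy? constancy-unbounded)
    fromU : ∀ {N} → (∃[ M ] + N ≡ + M × Constancy M) → Constancy N
    fromU (_ , refl , con) = con

  decrease : ∀ n .{{_ : NonZero n}} → DZ n ≡ + 2 * + ⌊ n φ⌋ + + n - + 4
  -- By evaluation: ⌊φ⌋ = 1 and 2 + 1 - 4 = -1.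
  decrease (suc zero)    = refl
  decrease (suc (suc m)) = trans
    (cong +_ (enumeration-unique (Enumeration.nth-isIncreasingEnumeration decrease? decrease-unbounded)
                                 decrease-enumeration m))
    (sym (decrease-formula m))
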